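{- A unit interval graph is $2$-nested (that is, has peak-nesting at most $2$) if and only if it is the line graph of a triangle-free multigraph.
   Context: Graphs are finite and are identified up to isomorphism when saying that a graph is a line graph. Write $[n]=\{1,\dots,n\}$. An area sequence of size $n$ is a sequence $\mathbf a=(a_1,\dots,a_n)$ of nonnegative integers with $a_i<i$ for all $i$ and $a_i\le a_{i-1}+1$ for all $i\ge 2$. It defines a graph $\Gamma_{\mathbf a}$ on $[n]$ with edges $\{j,i\}$ for $1\le j<i\le n$ with $i-a_i\le j$; unit interval graphs (on $[n]$) are the graphs $\Gamma_{\mathbf a}$. If $\{i,j\}$ with $i<j$ is an edge then $\{i,i+1,\dots,j\}$ is a clique. A peak-edge of $\Gamma_{\mathbf a}$ is either an isolated vertex $i$ (put $j=i$) or an edge $\{i,j\}$, $i<j$, such that neither $\{i,j+1\}$ nor $\{i-1,j\}$ is an edge (pairs not contained in $[n]$ are not edges). The corresponding peak-clique is $\{i,\dots,j\}$. The peak-nesting of a vertex is the number of peak-cliques containing it, and the peak-nesting of $\Gamma_{\mathbf a}$ is the maximum over all vertices. A multigraph is a pair $(V,F)$ with $V$ a set (the vertex set) and $F$ a multiset of elements of $\binom V1\cup\binom V2$ (the edge set; so loops and parallel edges are allowed). Its line graph is the graph whose vertices are the elements of $F$ (counted with multiplicity), two distinct ones being adjacent if and only if they share a common vertex of $V$. A multigraph is called triangle-free if it does not contain a triangle as an induced subgraph. -}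

module Defs where

open import Data.Fin.Base using (Fin; toℕ; _≤_; _<_)
open import Data.Fin.Properties using (_≟_; _≤?_; _<?_; all?; any?; <-irrefl)
open import Data.Fin.Subset using (Subset; ⁅_⁆; _∪_; _∈_; ∣_∣)
open import Data.Fin.Subset.Properties using (_∈?_; ∪-comm)
open import Data.Bool.Properties using () renaming (_≟_ to _≟ᵇ_)
open import Data.List.Base using (List; allFin; cartesianProduct; filter; length; map)
open import Data.List.Extrema.Nat using (max)
open import Data.Nat.Base as ℕ using (ℕ; suc; _∸_)
import Data.Nat.Properties as ℕ
open import Data.Product.Base using (Σ-syntax; ∃-syntax; _×_; _,_; proj₁; proj₂; swap)
open import Data.Sum.Base as Sum using (_⊎_; inj₁; inj₂)
open import Data.Vec.Properties using (≡-dec)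
open import Function.Base using (_∘_)
open import Function.Bundles using (_⇔_; _↔_; _↣_; Inverse; Injection)
open import Relation.Binary.Core using (Rel)
open import Relation.Binary.Definitions using (Decidable; Symmetric)
open import Relation.Binary.PropositionalEquality.Core
  using (_≡_; _≢_; refl; sym; trans; ≢-sym)
open import Relation.Nullary.Decidable using (¬?; _×-dec_; _⊎-dec_; _→-dec_)
open import Relation.Nullary.Negation.Core using (¬_)
open import Level using (0ℓ)

record Graph (n : ℕ) : Set₁ where
  field
    Adj    : Rel (Fin n) 0ℓ
    adj?   : Decidable Adj
    symm   : Symmetric Adj
    irrefl : ∀ {x} → ¬ Adj x x

infix 4 _≅_ _InducedIn_

_≅_ : ∀ {m n} → Graph m → Graph n → Set
_≅_ {m} {n} G H =
  Σ[ f ∈ Fin m ↔ Fin n ]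
    (∀ x y → Graph.Adj G x y ⇔ Graph.Adj H (Inverse.to f x) (Inverse.to f y))

_InducedIn_ : ∀ {m n} → Graph m → Graph n → Set
_InducedIn_ {m} {n} H G =
  Σ[ f ∈ Fin m ↣ Fin n ]
    (∀ x y → Graph.Adj H x y ⇔ Graph.Adj G (Injection.to f x) (Injection.to f y))

triangle : Graph 3
triangle = record
  { Adj    = _≢_
  ; adj?   = λ x y → ¬? (x ≟ y)
  ; symm   = ≢-sym
  ; irrefl = λ x≢x → x≢x refl
  }

-- Vertices are labelled 1, …, n: the element x of Fin n has label toℕ x + 1.
label : ∀ {n} → Fin n → ℕ
label x = suc (toℕ x)

record AreaSequence (n : ℕ) : Set where
  field
    area  : Fin n → ℕ
    bound : ∀ i → area i ℕ.< label i
    step  : ∀ h i → label i ≡ suc (label h) → area i ℕ.≤ suc (area h)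

module _ {n : ℕ} (a : AreaSequence n) where
  open AreaSequence a

  -- The truncated subtraction is exact, by `bound`.
  Edge : Rel (Fin n) 0ℓ
  Edge j i = j < i × label i ∸ area i ℕ.≤ label j

  edge? : Decidable Edge
  edge? j i = (j <? i) ×-dec (label i ∸ area i ℕ.≤? label j)

  Γ : Graph n
  Γ = record
    { Adj    = λ x y → Edge x y ⊎ Edge y x
    ; adj?   = λ x y → edge? x y ⊎-dec edge? y x
    ; symm   = Sum.swap
    ; irrefl = Sum.[ (λ e → <-irrefl refl (proj₁ e)) , (λ e → <-irrefl refl (proj₁ e)) ]
    }

module _ {n : ℕ} (G : Graph n) where
  open Graph G

  Isolated : Fin n → Set
  Isolated i = ∀ k → ¬ Adj i k

  -- The quantifiers over k range over the at most one vertex j + 1,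
  -- respectively i - 1, so a pair leaving the vertex set is not an edge.
  PeakEdge : Rel (Fin n) 0ℓ
  PeakEdge i j =
      (i ≡ j × Isolated i)
    ⊎ (i < j × Adj i j
        × (∀ k → label k ≡ suc (label j) → ¬ Adj i k)
        × (∀ k → label i ≡ suc (label k) → ¬ Adj k j))

  peakEdge? : Decidable PeakEdge
  peakEdge? i j =
      ((i ≟ j) ×-dec all? (λ k → ¬? (adj? i k)))
    ⊎-dec ((i <? j) ×-dec adj? i j
        ×-dec all? (λ k → (label k ℕ.≟ suc (label j)) →-dec ¬? (adj? i k))
        ×-dec all? (λ k → (label i ℕ.≟ suc (label k)) →-dec ¬? (adj? k j)))

  -- A peak-clique {i, …, j} is represented by its pair of endpoints (i , j),
  -- which determines it and is determined by it.
  peakCliques : List (Fin n × Fin n)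
  peakCliques =
    filter (λ (i , j) → peakEdge? i j) (cartesianProduct (allFin n) (allFin n))

  vertexPeakNesting : Fin n → ℕ
  vertexPeakNesting v =
    length (filter (λ (i , j) → (i ≤? v) ×-dec (v ≤? j)) peakCliques)

  peakNesting : ℕ
  peakNesting = max 0 (map vertexPeakNesting (allFin n))

-- The edge multiset is a family of vertex subsets indexed by Fin size;
-- repeated values are parallel edges and singletons are loops.
record Multigraph : Set where
  field
    order : ℕ
    size  : ℕ
    ends  : Fin size → Subset order
    card  : ∀ e → ∣ ends e ∣ ≡ 1 ⊎ ∣ ends e ∣ ≡ 2

module _ (M : Multigraph) where
  open Multigraph M

  lineGraph : Graph size
  lineGraph = record
    { Adj    = λ e f → e ≢ f × (∃[ v ] (v ∈ ends e × v ∈ ends f))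
    ; adj?   = λ e f →
        ¬? (e ≟ f) ×-dec any? (λ v → (v ∈? ends e) ×-dec (v ∈? ends f))
    ; symm   = λ (e≢f , v , v∈) → ≢-sym e≢f , v , swap v∈
    ; irrefl = λ e≁e → proj₁ e≁e refl
    }

  underlyingGraph : Graph order
  underlyingGraph = record
    { Adj    = λ u v → u ≢ v × (∃[ e ] ends e ≡ ⁅ u ⁆ ∪ ⁅ v ⁆)
    ; adj?   = λ u v →
        ¬? (u ≟ v) ×-dec any? (λ e → ≡-dec _≟ᵇ_ (ends e) (⁅ u ⁆ ∪ ⁅ v ⁆))
    ; symm   = λ {u} {v} (u≢v , e , eq) →
        ≢-sym u≢v , e , trans eq (∪-comm ⁅ u ⁆ ⁅ v ⁆)
    ; irrefl = λ u~u → proj₁ u~u refl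
    }

  -- Loops and edge multiplicities are disregarded: a triangle in which some
  -- edge is doubled, or some vertex carries a loop, still counts as a triangle.
  TriangleFree : Set
  TriangleFree = ¬ (triangle InducedIn underlyingGraph)

{-# OPTIONS --safe #-}
-- If Γ is 2-nested, take the peak-cliques as the vertices of a multigraph, a
-- vertex x of Γ becoming the edge whose ends are the one or two peak-cliques
-- containing x.  Peak-cliques are the maximal cliques, so adjacency in Γ is
-- incidence in the multigraph.  Peak-cliques are linearly ordered, and a vertex
-- in two of them lies in every peak-clique between, so that an edge joining the
-- outer two corners of a triangle would have three ends.
--
-- Conversely, pairwise intersecting edges of a triangle-free multigraph have a
-- common end.  A common end determines the maximal clique it comes from, and
-- each edge has at most two ends, hence lies in at most two maximal cliques.
module Submission where

open import Data.Nat.Base using (ℕ; _≤_)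
open import Data.Product.Base using (∃-syntax; _×_)
open import Function.Bundles using (_⇔_)
open import Defs

open import Data.Fin.Base as Fin using (Fin; zero; suc; toℕ; fromℕ<; inject₁)
open import Data.Fin.Induction using (<-wellFounded; >-wellFounded; <-weakInduction-startingFrom)
open import Data.Fin.Patterns using (0F; 1F; 2F)
import Data.Fin.Properties as Fin
open import Data.Fin.Subset using (Subset; ⁅_⁆; _∪_; _∈_; _-_; ∣_∣; Nonempty)
open import Data.Fin.Subset.Properties
open import Data.List.Base using (List; []; _∷_; filter; length; lookup; map; allFin; cartesianProduct)
open import Data.List.Extrema.Nat using (xs≤max; max≤v⁺)
import Data.List.Membership.Propositional as List
open import Data.List.Membership.Propositional.Properties
  using (∈-filter⁺; ∈-filter⁻; ∈-cartesianProduct⁺; ∈-allFin; ∈-lookup)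
open import Data.List.Relation.Unary.All as All using (All; []; _∷_)
import Data.List.Relation.Unary.All.Properties as All
open import Data.List.Relation.Unary.AllPairs using ([]; _∷_)
import Data.List.Relation.Unary.Any as Any
open import Data.List.Relation.Unary.Any.Properties using (lookup-index)
open import Data.List.Relation.Unary.Unique.Propositional using (Unique)
import Data.List.Relation.Unary.Unique.Propositional.Properties as Unique
open import Data.Nat.Base using (zero; suc; _+_; _∸_; z≤n; s≤s)
import Data.Nat.Properties as ℕ
open import Data.Product.Base using (Σ-syntax; _,_; proj₁; proj₂; uncurry)
open import Data.Sum.Base as Sum using (_⊎_; inj₁; inj₂; [_,_]′)
open import Data.Vec.Base using (tabulate)
open import Data.Vec.Properties using (lookup∘tabulate; lookup⇒[]=; []=⇒lookup)
open import Function.Base using (_∘_; _$_)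
open import Function.Bundles using (mk⇔; mk↣; Equivalence; Injection; Inverse)
open import Function.Construct.Identity using (↔-id)
open import Function.Properties.Inverse using (↔⇒↣)
open import Induction.WellFounded using (Acc; acc)
open import Relation.Binary.PropositionalEquality
  using (_≡_; _≢_; refl; sym; trans; cong; cong₂; subst; ≢-sym; subst₂)
open import Relation.Nullary using (¬_; Dec; yes; no; does; contradiction)
open import Relation.Nullary.Decidable using (dec-true; ¬?; _×-dec_; decidable-stable)
open import Relation.Unary using (Pred; Decidable)
open import Level using (0ℓ)

private
  variable
    n : ℕ

-- Extremal elements of Fin n

module _ {P : Pred (Fin n) 0ℓ} (P? : Decidable P) where

  maximalFrom : ∀ {y} → P y → ∃[ j ] (y Fin.≤ j × P j × (∀ {k} → P k → j Fin.≤ k → k ≡ j))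
  maximalFrom {y} = go (>-wellFounded y)
    where
    go : ∀ {y} → Acc Fin._>_ y → P y →
         ∃[ j ] (y Fin.≤ j × P j × (∀ {k} → P k → j Fin.≤ k → k ≡ j))
    go {y} (acc rs) py with Fin.any? (λ k → (y Fin.<? k) ×-dec P? k)
    ... | yes (k , y<k , pk) =
      let j , k≤j , rest = go (rs y<k) pk in j , ℕ.≤-trans (ℕ.<⇒≤ y<k) k≤j , rest
    ... | no ¬above = y , ℕ.≤-refl , py , λ {k} pk y≤k →
      decidable-stable (k Fin.≟ y) λ k≢y →
        ¬above (k , Fin.≤∧≢⇒< y≤k (≢-sym k≢y) , pk)

  minimalFrom : ∀ {y} → P y → ∃[ i ] (i Fin.≤ y × P i × (∀ {k} → P k → k Fin.≤ i → k ≡ i))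
  minimalFrom {y} = go (<-wellFounded y)
    where
    go : ∀ {y} → Acc Fin._<_ y → P y →
         ∃[ i ] (i Fin.≤ y × P i × (∀ {k} → P k → k Fin.≤ i → k ≡ i))
    go {y} (acc rs) py with Fin.any? (λ k → (k Fin.<? y) ×-dec P? k)
    ... | yes (k , k<y , pk) =
      let i , i≤k , rest = go (rs k<y) pk in i , ℕ.≤-trans i≤k (ℕ.<⇒≤ k<y) , rest
    ... | no ¬below = y , ℕ.≤-refl , py , λ {k} pk k≤y →
      decidable-stable (k Fin.≟ y) λ k≢y → ¬below (k , Fin.≤∧≢⇒< k≤y k≢y , pk)

successorBelow : {x y : Fin n} → x Fin.< y → Σ[ k ∈ Fin n ] (toℕ k ≡ suc (toℕ x) × k Fin.≤ y)
successorBelow {x = x} {y} x<y =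
  k , k≡ , subst (_≤ toℕ y) (sym k≡) x<y
  where
  bound = ℕ.≤-<-trans x<y (Fin.toℕ<n y)
  k  = fromℕ< bound
  k≡ = Fin.toℕ-fromℕ< bound

predecessorAbove : {x y : Fin n} → x Fin.< y → Σ[ k ∈ Fin n ] (toℕ y ≡ suc (toℕ k) × x Fin.≤ k)
predecessorAbove {suc _} {x} {suc y} (s≤s x≤y) =
  inject₁ y , cong suc (sym (Fin.toℕ-inject₁ y)) , subst (toℕ x ≤_) (sym (Fin.toℕ-inject₁ y)) x≤y

-- Singles out the middle corner `y` of a triangle whose corners are compared through `h`; ties are
-- allowed, so distinctness of the indices is recorded separately.
sortThree : (h : Fin 3 → ℕ) →
            ∃[ x ] ∃[ y ] ∃[ z ] (h x ≤ h y × h y ≤ h z × y ≢ x × y ≢ z × x ≢ z)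
sortThree h with ℕ.≤-total (h 0F) (h 1F) | ℕ.≤-total (h 1F) (h 2F) | ℕ.≤-total (h 0F) (h 2F)
... | inj₁ 0≤1 | inj₁ 1≤2 | _        = 0F , 1F , 2F , 0≤1 , 1≤2 , (λ ()) , (λ ()) , λ ()
... | inj₁ 0≤1 | inj₂ 2≤1 | inj₁ 0≤2 = 0F , 2F , 1F , 0≤2 , 2≤1 , (λ ()) , (λ ()) , λ ()
... | inj₁ 0≤1 | inj₂ 2≤1 | inj₂ 2≤0 = 2F , 0F , 1F , 2≤0 , 0≤1 , (λ ()) , (λ ()) , λ ()
... | inj₂ 1≤0 | inj₁ 1≤2 | inj₁ 0≤2 = 1F , 0F , 2F , 1≤0 , 0≤2 , (λ ()) , (λ ()) , λ ()
... | inj₂ 1≤0 | inj₁ 1≤2 | inj₂ 2≤0 = 1F , 2F , 0F , 1≤2 , 2≤0 , (λ ()) , (λ ()) , λ ()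
... | inj₂ 1≤0 | inj₂ 2≤1 | _        = 2F , 1F , 0F , 2≤1 , 1≤0 , (λ ()) , (λ ()) , λ ()

-- Cardinalities of subsets

module _ {A : Set} {P : Pred A 0ℓ} (P? : Decidable P) where

  -- Positions stand in for list entries because the vertices of a multigraph have to form some
  -- `Fin`.
  indicesOf : (xs : List A) → Subset (length xs)
  indicesOf xs = tabulate (λ k → does (P? (lookup xs k)))

  ∈-indicesOf⁺ : ∀ {xs k} → P (lookup xs k) → k ∈ indicesOf xs
  ∈-indicesOf⁺ {xs} {k} pk =
    lookup⇒[]= k _ (trans (lookup∘tabulate _ k) (dec-true (P? (lookup xs k)) pk))

  ∈-indicesOf⁻ : ∀ {xs k} → k ∈ indicesOf xs → P (lookup xs k)
  ∈-indicesOf⁻ {xs} {k} k∈ with P? (lookup xs k) | trans (sym (lookup∘tabulate _ k)) ([]=⇒lookup k∈)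
  ... | yes pk | _ = pk
  ... | no _   | ()

  ∣indicesOf∣ : ∀ xs → ∣ indicesOf xs ∣ ≡ length (filter P? xs)
  ∣indicesOf∣ []       = refl
  ∣indicesOf∣ (x ∷ xs) with P? x
  ... | yes _ = cong suc (∣indicesOf∣ xs)
  ... | no _  = ∣indicesOf∣ xs

-- Pigeonhole principle for a relation. The witness of the head is deleted from `S`; by `R-inj` no
-- other entry of the list can have it as its witness, so the induction continues in the smaller
-- set.
length≤∣S∣ : {A : Set} {R : A → Fin n → Set} →
             (∀ {x y w} → R x w → R y w → x ≡ y) →
             ∀ {xs} → Unique xs → (S : Subset n) →
             All (λ x → ∃[ w ] (w ∈ S × R x w)) xs → length xs ≤ ∣ S ∣
length≤∣S∣ R-inj [] S [] = z≤n
length≤∣S∣ {R = R} R-inj {x ∷ _} (x∉ ∷ u) S ((w , w∈S , xRw) ∷ rest) =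
  ℕ.≤-<-trans (length≤∣S∣ R-inj u (S - w) (All.zipWith avoid (x∉ , rest))) (x∈p⇒∣p-x∣<∣p∣ w∈S)
  where
  avoid : ∀ {y} → x ≢ y × ∃[ w′ ] (w′ ∈ S × R y w′) → ∃[ w′ ] (w′ ∈ S - w × R y w′)
  avoid (x≢y , w′ , w′∈S , yRw′) =
    w′ , x∈p∧x≢y⇒x∈p-y w′∈S (λ { refl → x≢y (R-inj xRw yRw′) }) , yRw′

Nonempty⇒1≤∣S∣ : {S : Subset n} → Nonempty S → 1 ≤ ∣ S ∣
Nonempty⇒1≤∣S∣ (_ , x∈S) = ℕ.≤-<-trans z≤n (x∈p⇒∣p-x∣<∣p∣ x∈S)

1≤∣S∣⇒Nonempty : {S : Subset n} → 1 ≤ ∣ S ∣ → Nonempty S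
1≤∣S∣⇒Nonempty {n} {S} 1≤ with nonempty? S
... | yes ne = ne
... | no ¬ne rewrite Empty-unique {p = S} ¬ne | ∣⊥∣≡0 n = contradiction 1≤ λ ()

∣S∣≤2⇒∈pair : {S : Subset n} → ∣ S ∣ ≤ 2 → ∀ {u v w} → u ∈ S → v ∈ S → u ≢ v →
              w ∈ S → w ≡ u ⊎ w ≡ v
∣S∣≤2⇒∈pair {S = S} ∣S∣≤2 {u} {v} {w} u∈ v∈ u≢v w∈ with w Fin.≟ u | w Fin.≟ v
... | yes w≡u | _       = inj₁ w≡u
... | no _    | yes w≡v = inj₂ w≡v
... | no w≢u  | no w≢v  = contradiction (ℕ.≤-trans three ∣S∣≤2) λ { (s≤s (s≤s ())) }
  where
  distinct : Unique (u ∷ v ∷ w ∷ [])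
  distinct = (u≢v ∷ ≢-sym w≢u ∷ []) ∷ (≢-sym w≢v ∷ []) ∷ [] ∷ []
  three : 3 ≤ ∣ S ∣
  three = length≤∣S∣ {R = _≡_} (λ { refl refl → refl }) distinct S
            ((u , u∈ , refl) ∷ (v , v∈ , refl) ∷ (w , w∈ , refl) ∷ [])

∣S∣≤2⇒≡pair : {S : Subset n} → ∣ S ∣ ≤ 2 → ∀ {u v} → u ∈ S → v ∈ S → u ≢ v → S ≡ ⁅ u ⁆ ∪ ⁅ v ⁆
∣S∣≤2⇒≡pair {S = S} ∣S∣≤2 {u} {v} u∈ v∈ u≢v = ⊆-antisym
  (λ w∈ → x∈p∪q⁺ ([ (λ { refl → inj₁ (x∈⁅x⁆ u) }) , (λ { refl → inj₂ (x∈⁅x⁆ v) }) ]′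
                    (∣S∣≤2⇒∈pair ∣S∣≤2 u∈ v∈ u≢v w∈)))
  (λ w∈ → [ (λ w∈u → subst (_∈ S) (sym (x∈⁅y⁆⇒x≡y u w∈u)) u∈)
          , (λ w∈v → subst (_∈ S) (sym (x∈⁅y⁆⇒x≡y v w∈v)) v∈) ]′ (x∈p∪q⁻ _ _ w∈))

∈pair⁻ : ∀ {u v w : Fin n} → w ∈ ⁅ u ⁆ ∪ ⁅ v ⁆ → w ≡ u ⊎ w ≡ v
∈pair⁻ {u = u} {v} = Sum.map (x∈⁅y⁆⇒x≡y u) (x∈⁅y⁆⇒x≡y v) ∘ x∈p∪q⁻ _ _

-- The two elements may coincide.
twoElements : {S : Subset n} → Nonempty S → ∣ S ∣ ≤ 2 →
              ∃[ u ] ∃[ v ] (u ∈ S × v ∈ S × (∀ {w} → w ∈ S → w ≡ u ⊎ w ≡ v))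
twoElements {S = S} (u , u∈) ∣S∣≤2 with Fin.any? (λ v → (v ∈? S) ×-dec ¬? (u Fin.≟ v))
... | yes (v , v∈ , u≢v) = u , v , u∈ , v∈ , ∣S∣≤2⇒∈pair ∣S∣≤2 u∈ v∈ u≢v
... | no ¬other = u , u , u∈ , u∈ , λ {w} w∈ →
  inj₁ (decidable-stable (w Fin.≟ u) λ w≢u → ¬other (w , w∈ , ≢-sym w≢u))

-- Multigraphs

module _ (G : Graph n) where
  open Graph G

  triangle-InducedIn : ∀ {u v w} → Adj u v → Adj u w → Adj v w → triangle InducedIn G
  triangle-InducedIn {u} {v} {w} uv uw vw =
    -- Distinct corners have adjacent images, so equal images would give a vertex adjacent to
    -- itself.
    mk↣ {to = f} (λ {x} {y} fx≡fy → decidable-stable (x Fin.≟ y) λ x≢y →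
      irrefl (subst (Adj (f x)) (sym fx≡fy) (adj x y x≢y)))
    , λ x y → mk⇔ (adj x y) λ fxy x≡y → irrefl (subst (Adj (f x) ∘ f) (sym x≡y) fxy)
    where
    f : Fin 3 → Fin n
    f zero             = u
    f (suc zero)       = v
    f (suc (suc zero)) = w

    adj : ∀ x y → x ≢ y → Adj (f x) (f y)
    adj zero             zero             x≢x = contradiction refl x≢x
    adj zero             (suc zero)       _   = uv
    adj zero             (suc (suc zero)) _   = uw
    adj (suc zero)       zero             _   = symm uv
    adj (suc zero)       (suc zero)       x≢x = contradiction refl x≢x
    adj (suc zero)       (suc (suc zero)) _   = vw
    adj (suc (suc zero)) zero             _   = symm uw
    adj (suc (suc zero)) (suc zero)       _   = symm vw
    adj (suc (suc zero)) (suc (suc zero)) x≢x = contradiction refl x≢x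

module _ (M : Multigraph) where
  open Multigraph M

  ∣ends∣≤2 : ∀ e → ∣ ends e ∣ ≤ 2
  ∣ends∣≤2 e with card e
  ... | inj₁ eq rewrite eq = s≤s z≤n
  ... | inj₂ eq rewrite eq = ℕ.≤-refl

  ends-nonempty : ∀ e → Nonempty (ends e)
  ends-nonempty e = 1≤∣S∣⇒Nonempty (1≤ (card e))
    where
    1≤ : ∀ {m} → m ≡ 1 ⊎ m ≡ 2 → 1 ≤ m
    1≤ (inj₁ refl) = s≤s z≤n
    1≤ (inj₂ refl) = s≤s z≤n

  Meet : Fin size → Fin size → Set
  Meet e f = ∃[ v ] (v ∈ ends e × v ∈ ends f)

  joins : ∀ e {u v} → u ∈ ends e → v ∈ ends e → u ≢ v → Graph.Adj (underlyingGraph M) u v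
  joins e u∈ v∈ u≢v = u≢v , e , ∣S∣≤2⇒≡pair (∣ends∣≤2 e) u∈ v∈ u≢v

  -- With u, v the ends of e₀, an edge of K avoiding u and an edge of K avoiding v
  -- would meet in a third vertex, and form a triangle with e₀.
  commonEnd : TriangleFree M → {K : Pred (Fin size) 0ℓ} → Decidable K →
              (∀ {e f} → K e → K f → Meet e f) → ∀ {e₀} → K e₀ →
              ∃[ w ] (∀ {e} → K e → w ∈ ends e)
  commonEnd Δ-free {K} K? meet {e₀} Ke₀
    with u , v , u∈e₀ , v∈e₀ , e₀⊆ ← twoElements (ends-nonempty e₀) (∣ends∣≤2 e₀)
    with Fin.any? (λ e → K? e ×-dec ¬? (u ∈? ends e)) | Fin.any? (λ e → K? e ×-dec ¬? (v ∈? ends e))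
  ... | no ¬e₁ | _      = u , λ {e} Ke → decidable-stable (u ∈? ends e) λ u∉ → ¬e₁ (e , Ke , u∉)
  ... | yes _  | no ¬e₂ = v , λ {e} Ke → decidable-stable (v ∈? ends e) λ v∉ → ¬e₂ (e , Ke , v∉)
  ... | yes (e₁ , Ke₁ , u∉e₁) | yes (e₂ , Ke₂ , v∉e₂) =
    contradiction
      (triangle-InducedIn (underlyingGraph M)
        (joins e₀ u∈e₀ v∈e₀ λ { refl → u∉e₁ v∈e₁ })
        (joins e₂ u∈e₂ w∈e₂ λ { refl → u∉e₁ w∈e₁ })
        (joins e₁ v∈e₁ w∈e₁ λ { refl → v∉e₂ w∈e₂ }))
      Δ-free
    where
    v∈e₁ : v ∈ ends e₁
    v∈e₁ with x , x∈e₀ , x∈e₁ ← meet Ke₀ Ke₁ with e₀⊆ x∈e₀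
    ... | inj₁ refl = contradiction x∈e₁ u∉e₁
    ... | inj₂ refl = x∈e₁
    u∈e₂ : u ∈ ends e₂
    u∈e₂ with x , x∈e₀ , x∈e₂ ← meet Ke₀ Ke₂ with e₀⊆ x∈e₀
    ... | inj₁ refl = x∈e₂
    ... | inj₂ refl = contradiction x∈e₂ v∉e₂
    w∈e₁ = proj₁ (proj₂ (meet Ke₁ Ke₂))
    w∈e₂ = proj₂ (proj₂ (meet Ke₁ Ke₂))

-- Peak-cliques of unit interval graphs

module _ (a : AreaSequence n) where
  open AreaSequence a

  -- The threshold of adjacency to the left: a smaller vertex is adjacent to `i` exactly when its
  -- label is at least this number.
  leftmost : Fin n → ℕ
  leftmost i = label i ∸ area i

  -- Comparing the two endpoints is enough for the whole interval to be a clique, because `leftmost`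
  -- is monotone. The case `i ≡ j` is included, so that single vertices count as cliques.
  CliqueInterval : Fin n → Fin n → Set
  CliqueInterval i j = i Fin.≤ j × leftmost j ≤ label i

  cliqueInterval? : ∀ i j → Dec (CliqueInterval i j)
  cliqueInterval? i j = (i Fin.≤? j) ×-dec (leftmost j ℕ.≤? label i)

leftmost-mono : (a : AreaSequence n) → ∀ {i j} → i Fin.≤ j → leftmost a i ≤ leftmost a j
leftmost-mono {suc n} a {i} = <-weakInduction-startingFrom
  (λ j → leftmost a i ≤ leftmost a j) ℕ.≤-refl λ j ih → ℕ.≤-trans ih (step′ j)
  where
  open AreaSequence a
  step′ : ∀ j → leftmost a (inject₁ j) ≤ leftmost a (suc j)
  step′ j = subst (λ m → suc m ∸ area (inject₁ j) ≤ leftmost a (suc j)) (sym (Fin.toℕ-inject₁ j)) $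
    -- The area condition is exactly monotonicity between neighbours: one `suc` cancels on each side
    -- of the subtraction for `inject₁ j`.
    ℕ.∸-monoʳ-≤ (suc (suc (toℕ j))) (step (inject₁ j) (suc j) (cong (2 +_) (sym (Fin.toℕ-inject₁ j))))

module _ (a : AreaSequence n) where
  open AreaSequence a
  open Graph (Γ a) using (Adj; irrefl)

  private
    Clique = CliqueInterval a
    Peak   = PeakEdge (Γ a)

  clique-refl : ∀ {i} → Clique i i
  clique-refl {i} = ℕ.≤-refl , ℕ.m∸n≤m (label i) (area i)

  subclique : ∀ {i j x y} → Clique i j → i Fin.≤ x → x Fin.≤ y → y Fin.≤ j → Clique x y
  subclique (_ , lj≤i) i≤x x≤y y≤j =
    x≤y , ℕ.≤-trans (leftmost-mono a y≤j) (ℕ.≤-trans lj≤i (s≤s i≤x))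

  clique⇒≡⊎Edge : ∀ {i j} → Clique i j → i ≡ j ⊎ Edge a i j
  clique⇒≡⊎Edge {i} {j} (i≤j , lj≤i) with i Fin.≟ j
  ... | yes i≡j = inj₁ i≡j
  ... | no i≢j  = inj₂ (Fin.≤∧≢⇒< i≤j i≢j , lj≤i)

  edge⇒clique : ∀ {i j} → Edge a i j → Clique i j
  edge⇒clique (i<j , lj≤i) = ℕ.<⇒≤ i<j , lj≤i

  adj∧≤⇒clique : ∀ {i j} → Adj i j → i Fin.≤ j → Clique i j
  adj∧≤⇒clique (inj₁ e)         i≤j = edge⇒clique e
  adj∧≤⇒clique (inj₂ (j<i , _)) i≤j = contradiction j<i (ℕ.≤⇒≯ i≤j)

  Maximal : Fin n → Fin n → Set
  Maximal i j = ∀ {i′ j′} → Clique i′ j′ → i′ Fin.≤ i → j Fin.≤ j′ → i′ ≡ i × j′ ≡ j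

  peak⇒clique : ∀ {i j} → Peak i j → Clique i j
  peak⇒clique (inj₁ (refl , _))            = clique-refl
  peak⇒clique (inj₂ (i<j , adj , _))       = adj∧≤⇒clique adj (ℕ.<⇒≤ i<j)

  -- A strictly larger clique contains, by `subclique`, the interval prolonged by just one vertex at
  -- one end, and this is the edge that a peak-edge excludes. For an isolated vertex, any larger
  -- clique already yields an edge at it.
  peak⇒maximal : ∀ {i j} → Peak i j → Maximal i j
  peak⇒maximal {i} (inj₁ (refl , isolated)) c i′≤i i≤j′ = left , right
    where
    left = [ (λ eq → eq) , (λ e → contradiction (inj₂ e) (isolated _)) ]′
             (clique⇒≡⊎Edge (subclique c ℕ.≤-refl i′≤i i≤j′))
    right = [ sym , (λ e → contradiction (inj₁ e) (isolated _)) ]′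
              (clique⇒≡⊎Edge (subclique c i′≤i i≤j′ ℕ.≤-refl))
  peak⇒maximal {i} {j} (inj₂ (i<j , _ , ¬right , ¬left)) {i′} {j′} c i′≤i j≤j′ = left , right
    where
    i≤j = ℕ.<⇒≤ i<j
    left : i′ ≡ i
    left = decidable-stable (i′ Fin.≟ i) λ i′≢i →
      let k , i≡sk , i′≤k = predecessorAbove (Fin.≤∧≢⇒< i′≤i i′≢i)
          k<i = ℕ.≤-reflexive (sym i≡sk)
          c′ : Clique k j
          c′ = subclique c i′≤k (ℕ.≤-trans (ℕ.<⇒≤ k<i) i≤j) j≤j′
      in ¬left k (cong suc i≡sk) (inj₁ (ℕ.<-trans k<i i<j , proj₂ c′))
    right : j′ ≡ j
    right = decidable-stable (j′ Fin.≟ j) λ j′≢j →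
      let k , k≡sj , k≤j′ = successorBelow (Fin.≤∧≢⇒< j≤j′ (≢-sym j′≢j))
          j<k = ℕ.≤-reflexive (sym k≡sj)
          c′ : Clique i k
          c′ = subclique c i′≤i (ℕ.≤-trans i≤j (ℕ.<⇒≤ j<k)) k≤j′
      in ¬right k (cong suc k≡sj) (inj₁ (ℕ.<-trans i<j j<k , proj₂ c′))

  maximal⇒peak : ∀ {i j} → Clique i j → Maximal i j → Peak i j
  maximal⇒peak {i} {j} c max with clique⇒≡⊎Edge c
  ... | inj₁ refl = inj₁ (refl , isolated)
    where
    isolated : ∀ k → ¬ Adj i k
    isolated k (inj₁ e) with refl ← proj₂ (max (edge⇒clique e) ℕ.≤-refl (ℕ.<⇒≤ (proj₁ e))) =
      irrefl (inj₁ e)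
    isolated k (inj₂ e) with refl ← proj₁ (max (edge⇒clique e) (ℕ.<⇒≤ (proj₁ e)) ℕ.≤-refl) =
      irrefl (inj₁ e)
  ... | inj₂ e@(i<j , _) = inj₂ (i<j , inj₁ e , ¬right , ¬left)
    where
    ¬right : ∀ k → label k ≡ suc (label j) → ¬ Adj i k
    ¬right k eq adj = ℕ.<-irrefl (sym (cong label k≡j)) (ℕ.≤-reflexive (sym eq))
      where
      j≤k = ℕ.<⇒≤ (ℕ.≤-reflexive (sym (ℕ.suc-injective eq)))
      k≡j = proj₂ (max (adj∧≤⇒clique adj (ℕ.≤-trans (ℕ.<⇒≤ i<j) j≤k)) ℕ.≤-refl j≤k)
    ¬left : ∀ k → label i ≡ suc (label k) → ¬ Adj k j
    ¬left k eq adj = ℕ.<-irrefl (cong label k≡i) (ℕ.≤-reflexive (sym eq))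
      where
      k≤i = ℕ.<⇒≤ (ℕ.≤-reflexive (sym (ℕ.suc-injective eq)))
      k≡i = proj₁ (max (adj∧≤⇒clique adj (ℕ.≤-trans k≤i (ℕ.<⇒≤ i<j))) k≤i ℕ.≤-refl)

  -- Greedy extension: first to the right as far as possible with `x` fixed, then to the left with
  -- the new right end `j` fixed.
  clique⊆peak : ∀ {x y} → Clique x y → ∃[ i ] ∃[ j ] (Peak i j × i Fin.≤ x × y Fin.≤ j)
  clique⊆peak {x} {y} cxy
    with j , y≤j , cxj , j-max ← maximalFrom (cliqueInterval? a x) cxy
    with i , i≤x , cij , i-min ← minimalFrom (λ i → cliqueInterval? a i j) cxj
    = i , j , maximal⇒peak cij maximal , i≤x , y≤j
    where
    maximal : Maximal i j
    maximal c i′≤i j≤j′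
      -- Extending to the left cannot make room on the right: a clique around `i` and `j` still
      -- contains the interval from `x` to `j′`, which the choice of `j` bounds.
      with refl ← j-max (subclique c (ℕ.≤-trans i′≤i i≤x) (ℕ.≤-trans (proj₁ cxj) j≤j′) ℕ.≤-refl) j≤j′
      = i-min c i′≤i , refl

  -- Otherwise the second peak-clique would lie inside the first, and maximality makes their right
  -- ends equal. Hence peak-cliques are linearly ordered by either endpoint.
  peak-mono : ∀ {i j i′ j′} → Peak i j → Peak i′ j′ → i Fin.≤ i′ → j Fin.≤ j′
  peak-mono {j = j} {j′ = j′} p p′ i≤i′ with ℕ.≤-total (toℕ j) (toℕ j′)
  ... | inj₁ j≤j′ = j≤j′
  ... | inj₂ j′≤j = ℕ.≤-reflexive
    (cong toℕ (proj₂ (peak⇒maximal p′ (peak⇒clique p) i≤i′ j′≤j)))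

  Covers : Fin n → Pred (Fin n × Fin n) 0ℓ
  Covers x (i , j) = i Fin.≤ x × x Fin.≤ j

  covers? : ∀ x → Decidable (Covers x)
  covers? x (i , j) = (i Fin.≤? x) ×-dec (x Fin.≤? j)

  covered⇒adj : ∀ {i j x y} → Clique i j → x ≢ y → Covers x (i , j) → Covers y (i , j) → Adj x y
  covered⇒adj {x = x} {y} c x≢y (i≤x , x≤j) (i≤y , y≤j) with ℕ.≤-total (toℕ x) (toℕ y)
  ... | inj₁ x≤y = inj₁ (Fin.≤∧≢⇒< x≤y x≢y , proj₂ (subclique c i≤x x≤y y≤j))
  ... | inj₂ y≤x = inj₂ (Fin.≤∧≢⇒< y≤x (≢-sym x≢y) , proj₂ (subclique c i≤y y≤x x≤j))

  peaks : List (Fin n × Fin n)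
  peaks = peakCliques (Γ a)

  peak⇒∈peaks : ∀ {i j} → Peak i j → (i , j) List.∈ peaks
  peak⇒∈peaks = ∈-filter⁺ (uncurry (peakEdge? (Γ a))) (∈-cartesianProduct⁺ (∈-allFin _) (∈-allFin _))

  ∈peaks⇒peak : ∀ {p} → p List.∈ peaks → uncurry Peak p
  ∈peaks⇒peak p∈ = proj₂ (∈-filter⁻ (uncurry (peakEdge? (Γ a))) {xs = cartesianProduct (allFin n) (allFin n)} p∈)

  -- The multigraph of peak-cliques of a 2-nested graph

  module _ (2-nested : peakNesting (Γ a) ≤ 2) where

    peakAt : Fin (length peaks) → Fin n × Fin n
    peakAt = lookup peaks

    peakAt-peak : ∀ k → uncurry Peak (peakAt k)
    peakAt-peak k = ∈peaks⇒peak (∈-lookup k)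

    peaksContaining : Fin n → Subset (length peaks)
    peaksContaining x = indicesOf (covers? x) peaks

    clique⇒commonPeak : ∀ {x y} → Clique x y →
      ∃[ k ] (k ∈ peaksContaining x × k ∈ peaksContaining y)
    clique⇒commonPeak {x} {y} c@(x≤y , _) =
      let i , j , p , i≤x , y≤j = clique⊆peak c
          ij≡ = lookup-index (peak⇒∈peaks p)
      in Any.index (peak⇒∈peaks p)
       , ∈-indicesOf⁺ (covers? x) {peaks} (subst (Covers x) ij≡ (i≤x , ℕ.≤-trans x≤y y≤j))
       , ∈-indicesOf⁺ (covers? y) {peaks} (subst (Covers y) ij≡ (ℕ.≤-trans i≤x x≤y , y≤j))

    ∣peaksContaining∣≤2 : ∀ x → ∣ peaksContaining x ∣ ≤ 2
    ∣peaksContaining∣≤2 x = subst (_≤ 2) (sym (∣indicesOf∣ (covers? x) peaks)) $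
      ℕ.≤-trans (All.lookup (All.map⁻ (xs≤max 0 (map (vertexPeakNesting (Γ a)) (allFin n)))) (∈-allFin x))
        2-nested

    peakMultigraph : Multigraph
    peakMultigraph = record
      { order = length peaks
      ; size  = n
      ; ends  = peaksContaining
      ; card  = λ x → 1⊎2 (Nonempty⇒1≤∣S∣ (nonempty x)) (∣peaksContaining∣≤2 x)
      }
      where
      nonempty : ∀ x → Nonempty (peaksContaining x)
      -- A single vertex is a clique, hence lies in some peak-clique.
      nonempty x = let k , k∈ , _ = clique⇒commonPeak (clique-refl {x}) in k , k∈
      1⊎2 : ∀ {m} → 1 ≤ m → m ≤ 2 → m ≡ 1 ⊎ m ≡ 2
      1⊎2 {1} _ _ = inj₁ refl
      1⊎2 {2} _ _ = inj₂ refl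
      1⊎2 {suc (suc (suc _))} _ (s≤s (s≤s ()))

    adj⇒lineAdj : ∀ {x y} → Adj x y → Graph.Adj (lineGraph peakMultigraph) x y
    adj⇒lineAdj (inj₁ e) = Fin.<⇒≢ (proj₁ e) , clique⇒commonPeak (edge⇒clique e)
    adj⇒lineAdj (inj₂ e) =
      let k , k∈y , k∈x = clique⇒commonPeak (edge⇒clique e)
      in ≢-sym (Fin.<⇒≢ (proj₁ e)) , k , k∈x , k∈y

    lineAdj⇒adj : ∀ {x y} → Graph.Adj (lineGraph peakMultigraph) x y → Adj x y
    lineAdj⇒adj {x} {y} (x≢y , k , k∈x , k∈y) =
      covered⇒adj (peak⇒clique (peakAt-peak k)) x≢y
        (∈-indicesOf⁻ (covers? x) {peaks} k∈x) (∈-indicesOf⁻ (covers? y) {peaks} k∈y)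

    Γ≅lineGraph : Γ a ≅ lineGraph peakMultigraph
    Γ≅lineGraph = ↔-id _ , λ _ _ → mk⇔ adj⇒lineAdj lineAdj⇒adj

    leftEnd : Fin (length peaks) → Fin n
    leftEnd k = proj₁ (peakAt k)

    -- The vertex `x` whose ends are `k` and `m` is not left of the left end of `m`, hence not of
    -- that of `l`; it is not right of the right end of `k`, hence not of that of `l`. So `l` is an
    -- end of `x` as well.
    betweenPeaks : ∀ {k l m} → leftEnd k Fin.≤ leftEnd l → leftEnd l Fin.≤ leftEnd m →
                   Graph.Adj (underlyingGraph peakMultigraph) k m → l ≡ k ⊎ l ≡ m
    betweenPeaks {k} {l} {m} k≤l l≤m (_ , x , ends≡) =
      ∈pair⁻ (subst (l ∈_) ends≡ (∈-indicesOf⁺ (covers? x) {peaks}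
        ( ℕ.≤-trans l≤m (proj₁ (∈-indicesOf⁻ (covers? x) {peaks} m∈))
        , ℕ.≤-trans (proj₂ (∈-indicesOf⁻ (covers? x) {peaks} k∈))
            (peak-mono (peakAt-peak k) (peakAt-peak l) k≤l))))
      where
      k∈ : k ∈ peaksContaining x
      k∈ = subst (k ∈_) (sym ends≡) (x∈p∪q⁺ (inj₁ (x∈⁅x⁆ k)))
      m∈ : m ∈ peaksContaining x
      m∈ = subst (m ∈_) (sym ends≡) (x∈p∪q⁺ (inj₂ (x∈⁅x⁆ m)))

    peakMultigraph-triangleFree : TriangleFree peakMultigraph
    peakMultigraph-triangleFree (f , adj⇔) =
      let x , y , z , x≤y , y≤z , y≢x , y≢z , x≢z = sortThree (toℕ ∘ leftEnd ∘ Injection.to f)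
      in [ y≢x ∘ Injection.injective f , y≢z ∘ Injection.injective f ]′
           (betweenPeaks x≤y y≤z (Equivalence.to (adj⇔ x z) x≢z))

  -- Bounding the peak-nesting of the line graph of a triangle-free multigraph

  module _ (M : Multigraph) (Δ-free : TriangleFree M) (iso : Γ a ≅ lineGraph M) where
    open Multigraph M
    open Inverse (proj₁ iso) using (to; from; strictlyInverseˡ; strictlyInverseʳ)

    clique⇒meet : ∀ {i j} → Clique i j → Meet M (to i) (to j)
    clique⇒meet {i} c with clique⇒≡⊎Edge c
    -- Line graph adjacency says nothing about an edge and itself; here any end of the edge serves.
    ... | inj₁ refl = let v , v∈ = ends-nonempty M (to i) in v , v∈ , v∈
    ... | inj₂ e    = proj₂ (Equivalence.to (proj₂ iso _ _) (inj₁ e))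

    meet⇒clique : ∀ {i j} → i Fin.≤ j → Meet M (to i) (to j) → Clique i j
    meet⇒clique {i} {j} i≤j m with i Fin.≟ j
    ... | yes refl = clique-refl
    ... | no i≢j   = adj∧≤⇒clique
      (Equivalence.from (proj₂ iso _ _) (i≢j ∘ Injection.injective (↔⇒↣ (proj₁ iso)) , m)) i≤j

    -- A common end of all edges that represent vertices of the peak-clique. `Peak i j` is part of
    -- the relation so that injectivity holds in the form required by `length≤∣S∣`.
    Centre : Fin n × Fin n → Fin order → Set
    Centre (i , j) w = Peak i j × (∀ {x} → Covers x (i , j) → w ∈ ends (to x))

    centre-exists : ∀ {i j} → Peak i j → ∃[ w ] Centre (i , j) w
    centre-exists {i} {j} p =
      -- The edges taken are those coming from the vertices of the peak-clique; they meet pairwise,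
      -- and the left end `i` supplies the initial one.
      let w , w∈ = commonEnd M Δ-free (λ e → covers? (from e) (i , j)) meet
                     (onto (ℕ.≤-refl , proj₁ c))
      in w , p , λ cov → w∈ (onto cov)
      where
      c = peak⇒clique p
      onto : ∀ {x} → Covers x (i , j) → Covers (from (to x)) (i , j)
      onto = subst (λ x → Covers x (i , j)) (sym (strictlyInverseʳ _))
      meetʳ : ∀ {x y} → Covers x (i , j) → Covers y (i , j) → Meet M (to x) (to y)
      meetʳ {x} {y} (i≤x , x≤j) (i≤y , y≤j) with ℕ.≤-total (toℕ x) (toℕ y)
      ... | inj₁ x≤y = clique⇒meet (subclique c i≤x x≤y y≤j)
      ... | inj₂ y≤x = let v , v∈y , v∈x = clique⇒meet (subclique c i≤y y≤x x≤j) in v , v∈x , v∈y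
      meet : ∀ {e f} → Covers (from e) (i , j) → Covers (from f) (i , j) → Meet M e f
      meet {e} {f} ce cf =
        subst₂ (Meet M) (strictlyInverseˡ e) (strictlyInverseˡ f) (meetʳ ce cf)

    -- The edges of the outermost vertices `i` and `j′` share the end `w`, so the interval from `i`
    -- to `j′` is a clique. It contains both peak-cliques, and maximality identifies each of them
    -- with it.
    centre-ordered : ∀ {i j i′ j′ w} → Centre (i , j) w → Centre (i′ , j′) w → i Fin.≤ i′ →
                     (i , j) ≡ (i′ , j′)
    centre-ordered {i} {j} {i′} {j′} (p , w∈) (p′ , w∈′) i≤i′ = cong₂ _,_
      (proj₁ (peak⇒maximal p′ hull i≤i′ ℕ.≤-refl))
      (sym (proj₂ (peak⇒maximal p hull ℕ.≤-refl (peak-mono p p′ i≤i′))))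
      where
      i≤j   = proj₁ (peak⇒clique p)
      i′≤j′ = proj₁ (peak⇒clique p′)
      hull : Clique i j′
      hull = meet⇒clique (ℕ.≤-trans i≤i′ i′≤j′)
        (_ , w∈ (ℕ.≤-refl , i≤j) , w∈′ (i′≤j′ , ℕ.≤-refl))

    centre-injective : ∀ {p q w} → Centre p w → Centre q w → p ≡ q
    centre-injective {i , _} {i′ , _} cp cq with ℕ.≤-total (toℕ i) (toℕ i′)
    ... | inj₁ i≤i′ = centre-ordered cp cq i≤i′
    ... | inj₂ i′≤i = sym (centre-ordered cq cp i′≤i)

    -- Each peak-clique containing `x` has a centre among the at most two ends of `to x`, and
    -- different peak-cliques have different centres.
    vertexPeakNesting≤2 : ∀ x → vertexPeakNesting (Γ a) x ≤ 2
    vertexPeakNesting≤2 x = ℕ.≤-trans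
      (length≤∣S∣ {R = Centre} centre-injective (Unique.filter⁺ (covers? x) peaks-unique) (ends (to x))
        (All.tabulate λ p∈ →
          let p∈peaks , cov = ∈-filter⁻ (covers? x) {xs = peaks} p∈
              w , c = centre-exists (∈peaks⇒peak p∈peaks)
          in w , proj₂ c cov , c))
      (∣ends∣≤2 M (to x))
      where
      peaks-unique : Unique peaks
      peaks-unique = Unique.filter⁺ (uncurry (peakEdge? (Γ a)))
        (Unique.cartesianProduct⁺ (Unique.allFin⁺ n) (Unique.allFin⁺ n))

    peakNesting≤2 : peakNesting (Γ a) ≤ 2
    peakNesting≤2 = max≤v⁺ {xs = map (vertexPeakNesting (Γ a)) (allFin n)} z≤n (All.map⁺ {f = vertexPeakNesting (Γ a)} (All.tabulate λ {x} _ → vertexPeakNesting≤2 x))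

proposition5p2 : (n : ℕ) (a : AreaSequence n) →
    (peakNesting (Γ a) ≤ 2) ⇔ (∃[ M ] (TriangleFree M × Γ a ≅ lineGraph M))
proposition5p2 n a = mk⇔
  (λ 2-nested → peakMultigraph a 2-nested
              , peakMultigraph-triangleFree a 2-nested
              , Γ≅lineGraph a 2-nested)
  (λ (M , Δ-free , iso) → peakNesting≤2 a M Δ-free iso)
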